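{- Let $\mathcal{B}=\{f,\bot,\top,t\}$ be Belnap's 4-valued bilattice, let $\partial:(\mathcal{B},\leq_t,\alpha_t)\cong(\mathcal{B},\leq_k,\alpha_k)$ be its D-bilattice isomorphism, with $\alpha_t=\{\wedge,\rightharpoonup,-\}$ and $\alpha_k=\{\otimes,\rightharpoondown,\neg\}$, and let $I:Var\to\mathcal{B}$ be a many-valued interpretation of the intuitionistic autoepistemic logic $\mathcal{L}=(Var,\{\wedge,\Rightarrow,\flat\},\Vvdash)$. Let $\partial_{\mathcal{P}}$ be the extension of $\partial$ to sets, $\partial_{\mathcal{P}}X=\{\partial x\mid x\in X\}\in\mathcal{P}(1_k)$ for $X\in\mathcal{P}(1_t)$, and let $\partial^*_{\mathcal{P}}$ be its restriction to $\mathcal{B}^+_t$ and $\mathcal{B}^+_k$. Put $I'=\partial I$, $I_t=\downarrow^+_tI$, $I_k=\downarrow^+_k\partial I$; here $\mathcal{B}^+_k=\partial^*_{\mathcal{P}}(\mathcal{B}^+_t)$ and $1_k=\partial_{\mathcal{P}}(1_t)$. Then the following diagram of algebraic models of $\mathcal{L}$ commutes: $$\begin{array}{ccc} ((\mathcal{B},\leq_t,\alpha_t),I) & \xrightarrow{\ \partial\ } & ((\mathcal{B},\leq_k,\alpha_k),I')\\ \downarrow^+_t\Big\downarrow & & \Big\downarrow\downarrow^+_k\\ ((\mathcal{B}^+_t,\{\cap,\rightharpoonup^+,\diamond_t\}),I_t) & \xrightarrow{\ \partial^*_{\mathcal{P}}\ } & ((\mathcal{B}^+_k,\{\cap,\rightharpoondown^+,\diamond_k\}),I_k)\\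 i_t\Big\downarrow & & \Big\downarrow i_k\\ ((\mathcal{P}(1_t),\{\cap,\rightharpoonup^+,\diamond_t\}),I_t) & \xrightarrow{\ \partial_{\mathcal{P}}\ } & ((\mathcal{P}(1_k),\{\cap,\rightharpoondown^+,\diamond_k\}),I_k)\\ =\Big\downarrow & & \Big\downarrow=\\ (\mathbb{E}\circ\mathbb{D})((\mathcal{B},\leq_t,\alpha_t),I) & \xrightarrow{\ \partial_{\mathcal{P}}\ } & (\mathbb{E}\circ\mathbb{D})((\mathcal{B},\leq_k,\alpha_k),I') \end{array}$$ where $i_t,i_k$ (the inclusions) are injective homomorphisms, $\downarrow^+_t,\downarrow^+_k$ are the isomorphisms $\downarrow^+$ with respect to the truth and knowledge orderings respectively, and $\partial_{\mathcal{P}}$ is an isomorphism.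
   Context: **Belnap's bilattice.** On $\mathcal{B}=\{f,\bot,\top,t\}$ there are two orders. Truth order: $f\leq_t\bot\leq_tt$ and $f\leq_t\top\leq_tt$, with $\bot,\top$ incomparable; meet and join are $\wedge,\vee$. Knowledge order: $\bot\leq_kf\leq_k\top$ and $\bot\leq_kt\leq_k\top$, with $f,t$ incomparable; meet and join are $\otimes,\oplus$. Truth negation $\neg$ swaps $f,t$ and fixes $\bot,\top$. Conflation $-$ swaps $\bot,\top$ and fixes $f,t$. $\rightharpoonup$ and $\rightharpoondown$ are the relative pseudocomplements for $\leq_t$ and $\leq_k$. The D-bilattice isomorphism $\partial$ is the order isomorphism $(\mathcal{B},\leq_t)\simeq(\mathcal{B},\leq_k)$ that is an involution, i.e. $f\leftrightarrow\bot$, $t\leftrightarrow\top$. **Set representations.** For a complete distributive lattice, $\downarrow^+x$ is the set of all $y\sqsubseteq x$ with $y$ join-irreducible or $y$ the bottom. For $\leq_t$ this is denoted $\downarrow^+_t$: $f\mapsto\{f\}$, $\bot\mapsto\{f,\bot\}$, $\top\mapsto\{f,\top\}$, $t\mapsto\{f,\bot,\top\}$; its image is $\mathcal{B}^+_t$, and $1_t=\{f,\bot,\top\}$. For $\leq_k$ it is denoted $\downarrow^+_k$: $\bot\mapsto\{\bot\}$, $f\mapsto\{\bot,f\}$, $t\mapsto\{\bot,t\}$, $\top\mapsto\{\bot,f,t\}$; its image is $\mathcal{B}^+_k$, and $1_k=\{\bot,f,t\}$. **Operations on sets.** $\rightharpoonup^+$ and $\rightharpoondown^+$ are the relative pseudocomplements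 with respect to $\subseteq$: $X\rightharpoonup^+Y=\bigcup\{Z\mid Z\cap X\subseteq Y\}$ in $\mathcal{P}(1_t)$ and likewise in $\mathcal{P}(1_k)$; on $\mathcal{B}^+_t$, $\mathcal{B}^+_k$ they are given by $\downarrow^+\rightharpoonup\bigvee$ and $\downarrow^+\rightharpoondown\bigvee$ (apply suprema to the arguments, then the operation, then $\downarrow^+$). $\diamond_tX=\{ -x\mid x\in X\}$ for $X\in\mathcal{P}(1_t)$ and $\diamond_kY=\{\neg y\mid y\in Y\}$ for $Y\in\mathcal{P}(1_k)$. **Models.** The connectives $\wedge,\Rightarrow,\flat$ of $\mathcal{L}$ are interpreted by $\wedge,\rightharpoonup,-$ in $(\mathcal{B},\leq_t)$, by $\otimes,\rightharpoondown,\neg$ in $(\mathcal{B},\leq_k)$, and by the corresponding three listed operations in the set algebras. A homomorphism of algebraic models $h:(\mathbf{A},J)\to(\mathbf{A}',J')$ is a homomorphism of these algebras with $h\circ J=J'$. $\mathbb{D}$ sends $((\mathcal{B},\leq_t,\alpha_t),I)$ to the Kripke model with set of worlds $1_t$ and valuation $I_t$, and $\mathbb{E}$ sends that Kripke model to the powerset algebra $(\mathcal{P}(1_t),\{\cap,\rightharpoonup^+,\diamond_t\})$ with interpretation $I_t$; similarly for $\leq_k$ with $1_k$, $I_k$ and $\{\cap,\rightharpoondown^+,\diamond_k\}$. -}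

module Defs where

open import Algebra.Core using (Op₁; Op₂)
open import Algebra.Morphism.Definitions using (Homomorphic₁; Homomorphic₂)
open import Data.Bool.Base using (true)
open import Data.Fin.Base using (Fin; zero; suc)
open import Data.Fin.Properties using (_≟_; any?; all?)
open import Data.Fin.Subset using (Subset; _∈_; _⊆_; _∩_; _∪_; ⁅_⁆)
open import Data.Fin.Subset.Properties using (_∈?_; _⊆?_; ⊆-antisym; x∈p∩q⁺; x∈p∩q⁻; p∩q⊆p; anySubset?)
open import Data.Irrelevant using ([_])
open import Data.List.Base using (foldr; filter; allFin)
open import Data.Nat.Base using (ℕ)
open import Data.Product.Base using (_×_; _,_; proj₁; proj₂; ∃)
open import Data.Refinement using (Refinement; _,_; value)
open import Data.Sum.Base as Sum using (_⊎_; inj₁; inj₂)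
open import Data.Vec.Base using (tabulate; lookup)
open import Data.Vec.Properties using (lookup∘tabulate; []=⇒lookup; lookup⇒[]=)
open import Function.Definitions using (Injective; Bijective)
open import Level using (0ℓ)
open import Relation.Binary.Core using (Rel)
open import Relation.Binary.Definitions using (Decidable)
open import Relation.Binary.Lattice.Structures using (IsHeytingAlgebra)
open import Relation.Binary.Morphism.Structures using (IsOrderIsomorphism)
open import Relation.Binary.PropositionalEquality
open import Relation.Nullary.Decidable using (Dec; yes; no; does; dec-true; _×-dec_; _⊎-dec_; _→-dec_; ¬?; from-yes)
open import Relation.Nullary.Negation using (¬_; contradiction)
open import Relation.Unary using (Pred) renaming (Decidable to Decidable₁)

private variable
  m n : ℕ
  Var : Set

------------------------------------------------------------------------
-- Finite sets

comprehension : {P : Pred (Fin n) 0ℓ} → Decidable₁ P → Subset n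
comprehension P? = tabulate (λ x → does (P? x))

module _ {P : Pred (Fin n) 0ℓ} (P? : Decidable₁ P) where

  ∈-comprehension⁺ : ∀ {x} → P x → x ∈ comprehension P?
  ∈-comprehension⁺ {x} px = lookup⇒[]= x _
    (trans (lookup∘tabulate _ x) (dec-true (P? x) px))

  ∈-comprehension⁻ : ∀ {x} → x ∈ comprehension P? → P x
  ∈-comprehension⁻ {x} x∈ = true⇒ (P? x)
    (trans (sym (lookup∘tabulate _ x)) ([]=⇒lookup x∈))
    where
    true⇒ : ∀ {A : Set} (A? : Dec A) → does A? ≡ true → A
    true⇒ (yes a) _ = a

-- { h x ∣ x ∈ X }
image : (Fin m → Fin n) → Subset m → Subset n
image h X = comprehension (λ y → any? (λ x → (x ∈? X) ×-dec (y ≟ h x)))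

module _ (h : Fin m → Fin n) {X : Subset m} where

  private
    Q? : Decidable₁ (λ y → ∃ λ x → x ∈ X × y ≡ h x)
    Q? y = any? (λ x → (x ∈? X) ×-dec (y ≟ h x))

  ∈-image⁺ : ∀ {x} → x ∈ X → h x ∈ image h X
  ∈-image⁺ x∈X = ∈-comprehension⁺ Q? (_ , x∈X , refl)

  ∈-image⁻ : ∀ {y} → y ∈ image h X → ∃ λ x → x ∈ X × y ≡ h x
  ∈-image⁻ = ∈-comprehension⁻ Q?

image-mono : (h : Fin m → Fin n) {X Y : Subset m} → X ⊆ Y → image h X ⊆ image h Y
image-mono h X⊆Y y∈ with x , x∈X , refl ← ∈-image⁻ h y∈ = ∈-image⁺ h (X⊆Y x∈X)

-- The membership proof is irrelevant, so _≡_ on 𝒫 W is equality of sets.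
𝒫 : Subset n → Set
𝒫 {n} W = Refinement (Subset n) (_⊆ W)

-- ⋃ { Z ∈ 𝒫 W ∣ Z ∩ X ⊆ Y }
pseudocomplement : (W X Y : Subset n) → Subset n
pseudocomplement W X Y = comprehension λ w →
  anySubset? (λ Z → (Z ⊆? W) ×-dec ((Z ∩ X) ⊆? Y) ×-dec (w ∈? Z))

pseudocomplement-⊆ : (W X Y : Subset n) → pseudocomplement W X Y ⊆ W
pseudocomplement-⊆ W X Y w∈ with Z , Z⊆W , _ , w∈Z ← ∈-comprehension⁻
  (λ w → anySubset? (λ Z → (Z ⊆? W) ×-dec ((Z ∩ X) ⊆? Y) ×-dec (w ∈? Z))) w∈ = Z⊆W w∈Z

_∩ᵂ_ : {W : Subset n} → Op₂ (𝒫 W)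
(X , [ X⊆W ]) ∩ᵂ (Y , _) = X ∩ Y , [ (λ x∈ → X⊆W (p∩q⊆p X Y x∈)) ]

_⇀⁺_ : {W : Subset n} → Op₂ (𝒫 W)
_⇀⁺_ {W = W} (X , _) (Y , _) = pseudocomplement W X Y , [ pseudocomplement-⊆ W X Y ]

------------------------------------------------------------------------
-- Algebraic models of the language {∧, ⇒, ♭}

record Model (Var : Set) : Set₁ where
  field
    Carrier : Set
    _∧_ _⇒_ : Op₂ Carrier
    ♭       : Op₁ Carrier
    ⟦_⟧     : Var → Carrier

module _ (M N : Model Var) where
  private
    module M = Model M
    module N = Model N

  record IsModelHomomorphism (h : M.Carrier → N.Carrier) : Set where
    field
      ∧-homo : Homomorphic₂ M.Carrier N.Carrier _≡_ h M._∧_ N._∧_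
      ⇒-homo : Homomorphic₂ M.Carrier N.Carrier _≡_ h M._⇒_ N._⇒_
      ♭-homo : Homomorphic₁ M.Carrier N.Carrier _≡_ h M.♭ N.♭
      ⟦⟧-homo : ∀ p → h M.⟦ p ⟧ ≡ N.⟦ p ⟧

  record IsModelMonomorphism (h : M.Carrier → N.Carrier) : Set where
    field
      isModelHomomorphism : IsModelHomomorphism h
      injective           : Injective _≡_ _≡_ h

  record IsModelIsomorphism (h : M.Carrier → N.Carrier) : Set where
    field
      isModelHomomorphism : IsModelHomomorphism h
      bijective           : Bijective _≡_ _≡_ h

------------------------------------------------------------------------
-- Finite Heyting algebras (in particular complete distributive lattices)
-- with an order automorphism

record AutoHeytingAlgebra (n : ℕ) : Set₁ where
  infix 4 _≤_ _≤?_
  field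
    _≤_              : Rel (Fin n) 0ℓ
    _≤?_             : Decidable _≤_
    _∨_ _∧_ _⇒_      : Op₂ (Fin n)
    top bot          : Fin n
    isHeytingAlgebra : IsHeytingAlgebra _≡_ _≤_ _∨_ _∧_ _⇒_ top bot
    ♭                : Op₁ (Fin n)
    ♭-automorphism   : IsOrderIsomorphism _≡_ _≡_ _≤_ _≤_ ♭

  private
    module H = IsHeytingAlgebra isHeytingAlgebra
    module ♭ = IsOrderIsomorphism ♭-automorphism

  JoinIrreducible : Pred (Fin n) 0ℓ
  JoinIrreducible y = ¬ (y ≡ bot) × (∀ a b → y ≡ a ∨ b → y ≡ a ⊎ y ≡ b)

  joinIrreducible? : Decidable₁ JoinIrreducible
  joinIrreducible? y = ¬? (y ≟ bot) ×-dec
    all? (λ a → all? (λ b → (y ≟ (a ∨ b)) →-dec ((y ≟ a) ⊎-dec (y ≟ b))))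

  ↓-member? : ∀ x → Decidable₁ (λ y → y ≤ x × (JoinIrreducible y ⊎ y ≡ bot))
  ↓-member? x y = (y ≤? x) ×-dec (joinIrreducible? y ⊎-dec (y ≟ bot))

  ↓⁺ : Fin n → Subset n
  ↓⁺ x = comprehension (↓-member? x)

  𝟏 : Subset n
  𝟏 = ↓⁺ top

  ⋁ : Subset n → Fin n
  ⋁ X = foldr _∨_ bot (filter (_∈? X) (allFin n))

  Is↓⁺ : Pred (Subset n) 0ℓ
  Is↓⁺ X = ∃ λ x → ↓⁺ x ≡ X

  𝓑⁺ : Set
  𝓑⁺ = Refinement (Subset n) Is↓⁺

  ↓ : Fin n → 𝓑⁺
  ↓ x = ↓⁺ x , [ (x , refl) ]

  ↓⁺⊆𝟏 : ∀ x → ↓⁺ x ⊆ 𝟏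
  ↓⁺⊆𝟏 x y∈ with _ , y-irr ← ∈-comprehension⁻ (↓-member? x) y∈ =
    ∈-comprehension⁺ (↓-member? top) (H.maximum _ , y-irr)

  inclusion : 𝓑⁺ → 𝒫 𝟏
  inclusion (X , [ p ]) = X , [ (λ x∈ → subst (_⊆ 𝟏) (proj₂ p) (↓⁺⊆𝟏 (proj₁ p)) x∈) ]

  ↓⁺-∧ : ∀ x y → ↓⁺ (x ∧ y) ≡ ↓⁺ x ∩ ↓⁺ y
  ↓⁺-∧ x y = ⊆-antisym
    (λ z∈ → let z≤ , z-irr = ∈-comprehension⁻ (↓-member? (x ∧ y)) z∈ in
      x∈p∩q⁺ ( ∈-comprehension⁺ (↓-member? x) (H.trans z≤ (H.x∧y≤x x y) , z-irr)
             , ∈-comprehension⁺ (↓-member? y) (H.trans z≤ (H.x∧y≤y x y) , z-irr)))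
    (λ z∈ → let z∈x , z∈y = x∈p∩q⁻ (↓⁺ x) (↓⁺ y) z∈
                z≤x , z-irr = ∈-comprehension⁻ (↓-member? x) z∈x
                z≤y , _     = ∈-comprehension⁻ (↓-member? y) z∈y
            in ∈-comprehension⁺ (↓-member? (x ∧ y)) (H.∧-greatest z≤x z≤y , z-irr))

  private
    ♭-surj : ∀ y → ∃ λ x → y ≡ ♭ x
    ♭-surj y with x , eq ← ♭.surjective y = x , sym (eq refl)

    ♭-bot : ♭ bot ≡ bot
    ♭-bot with x , eq ← ♭-surj bot =
      H.antisym (subst (♭ bot ≤_) (sym eq) (♭.mono (H.minimum x))) (H.minimum _)

    ♭-∨ : ∀ a b → ♭ (a ∨ b) ≡ ♭ a ∨ ♭ b
    ♭-∨ a b with c , eq ← ♭-surj (♭ a ∨ ♭ b) = H.antisym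
      (subst (♭ (a ∨ b) ≤_) (sym eq) (♭.mono (H.∨-least
        (♭.cancel (subst (♭ a ≤_) eq (H.x≤x∨y _ _)))
        (♭.cancel (subst (♭ b ≤_) eq (H.y≤x∨y _ _))))))
      (H.∨-least (♭.mono (H.x≤x∨y a b)) (♭.mono (H.y≤x∨y a b)))

    ♭-irr : ∀ {y} → JoinIrreducible y → JoinIrreducible (♭ y)
    ♭-irr {y} (y≢bot , irr) =
      (λ ♭y≡bot → y≢bot (♭.injective (trans ♭y≡bot (sym ♭-bot)))) , λ a b → go a b (♭-surj a) (♭-surj b)
      where
      go : ∀ a b → (∃ λ a′ → a ≡ ♭ a′) → (∃ λ b′ → b ≡ ♭ b′) → ♭ y ≡ a ∨ b → ♭ y ≡ a ⊎ ♭ y ≡ b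
      go _ _ (a , refl) (b , refl) eq = Sum.map (cong ♭) (cong ♭)
        (irr a b (♭.injective (trans eq (sym (♭-∨ a b)))))

    ♭-irr⁻ : ∀ {y} → JoinIrreducible (♭ y) → JoinIrreducible y
    ♭-irr⁻ (♭y≢bot , irr) =
      (λ y≡bot → ♭y≢bot (trans (cong ♭ y≡bot) ♭-bot)) ,
      λ a b eq → Sum.map ♭.injective ♭.injective (irr (♭ a) (♭ b) (trans (cong ♭ eq) (♭-∨ a b)))

  ↓⁺-♭ : ∀ x → ↓⁺ (♭ x) ≡ image ♭ (↓⁺ x)
  ↓⁺-♭ x = ⊆-antisym to from
    where
    to : ↓⁺ (♭ x) ⊆ image ♭ (↓⁺ x)
    to {z} z∈ with ♭-surj z
    ... | y , refl with ♭y≤♭x , ♭y-irr ← ∈-comprehension⁻ (↓-member? (♭ x)) z∈ =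
      ∈-image⁺ ♭ (∈-comprehension⁺ (↓-member? x)
        (♭.cancel ♭y≤♭x , Sum.map ♭-irr⁻ (λ eq → ♭.injective (trans eq (sym ♭-bot))) ♭y-irr))

    from : image ♭ (↓⁺ x) ⊆ ↓⁺ (♭ x)
    from z∈ with y , y∈ , refl ← ∈-image⁻ ♭ z∈ with y≤x , y-irr ← ∈-comprehension⁻ (↓-member? x) y∈ =
      ∈-comprehension⁺ (↓-member? (♭ x))
        (♭.mono y≤x , Sum.map ♭-irr (λ eq → trans (cong ♭ eq) ♭-bot) y-irr)

  ♭-𝟏 : ∀ {x} → x ∈ 𝟏 → ♭ x ∈ 𝟏
  ♭-𝟏 x∈𝟏 = ↓⁺⊆𝟏 (♭ top) (subst (_ ∈_) (sym (↓⁺-♭ top)) (∈-image⁺ ♭ x∈𝟏))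

  ◇ : Op₁ (𝒫 𝟏)
  ◇ (X , [ X⊆𝟏 ]) = image ♭ X , [ (λ y∈ → image⊆𝟏 X⊆𝟏 y∈) ]
    where
    image⊆𝟏 : ∀ {X} → X ⊆ 𝟏 → image ♭ X ⊆ 𝟏
    image⊆𝟏 X⊆𝟏 y∈ with x , x∈X , refl ← ∈-image⁻ ♭ y∈ = ♭-𝟏 (X⊆𝟏 x∈X)

  baseModel : (Var → Fin n) → Model Var
  baseModel I = record
    { Carrier = Fin n ; _∧_ = _∧_ ; _⇒_ = _⇒_ ; ♭ = ♭ ; ⟦_⟧ = I }

  ↓Model : (Var → Fin n) → Model Var
  ↓Model I = record
    { Carrier = 𝓑⁺
    ; _∧_     = λ { (X , [ p ]) (Y , [ q ]) → X ∩ Y ,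
                    [ (proj₁ p ∧ proj₁ q , trans (↓⁺-∧ _ _) (cong₂ _∩_ (proj₂ p) (proj₂ q))) ] }
    ; _⇒_     = λ X Y → ↓ (⋁ (value X) ⇒ ⋁ (value Y))
    ; ♭       = λ { (X , [ p ]) → image ♭ X ,
                    [ (♭ (proj₁ p) , trans (↓⁺-♭ _) (cong (image ♭) (proj₂ p))) ] }
    ; ⟦_⟧     = λ p → ↓ (I p)
    }

  𝒫Model : (Var → Fin n) → Model Var
  𝒫Model I = record
    { Carrier = 𝒫 𝟏 ; _∧_ = _∩ᵂ_ ; _⇒_ = _⇀⁺_ ; ♭ = ◇ ; ⟦_⟧ = λ p → inclusion (↓ (I p)) }

------------------------------------------------------------------------
-- Kripke models

-- R is the accessibility relation of the modality ♭:  w ⊩ ♭ φ  iff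
-- v ⊩ φ for some v with R w v.  R-closed makes the set of such w a set
-- of worlds.
record KripkeModel (n : ℕ) (Var : Set) : Set₁ where
  field
    worlds   : Subset n
    R        : Rel (Fin n) 0ℓ
    R?       : Decidable R
    R-closed : ∀ {w v} → R w v → v ∈ worlds → w ∈ worlds
    V        : Var → 𝒫 worlds

-- ♭ is a function on truth values, so R w v means that w is ♭ v.
𝔻 : AutoHeytingAlgebra n → (Var → Fin n) → KripkeModel n Var
𝔻 A I = record
  { worlds   = 𝟏
  ; R        = λ w v → w ≡ ♭ v
  ; R?       = λ w v → w ≟ ♭ v
  ; R-closed = λ { refl v∈𝟏 → ♭-𝟏 v∈𝟏 }
  ; V        = λ p → inclusion (↓ (I p))
  }
  where open AutoHeytingAlgebra A

𝔼 : KripkeModel n Var → Model Var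
𝔼 {n} K = record
  { Carrier = 𝒫 worlds ; _∧_ = _∩ᵂ_ ; _⇒_ = _⇀⁺_ ; ♭ = ◇R ; ⟦_⟧ = V }
  where
  open KripkeModel K

  ◇? : ∀ X → Decidable₁ (λ w → ∃ λ v → v ∈ X × R w v)
  ◇? X w = any? (λ v → (v ∈? X) ×-dec R? w v)

  ◇⊆ : ∀ X → X ⊆ worlds → comprehension (◇? X) ⊆ worlds
  ◇⊆ X X⊆ w∈ with v , v∈X , Rwv ← ∈-comprehension⁻ (◇? X) w∈ = R-closed Rwv (X⊆ v∈X)

  ◇R : Op₁ (𝒫 worlds)
  ◇R (X , [ X⊆ ]) = comprehension (◇? X) , [ (λ w∈ → ◇⊆ X X⊆ w∈) ]

------------------------------------------------------------------------
-- Belnap's bilattice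

-- Fin 4, so that subsets of 𝓑 are elements of Subset 4.  The numeric
-- order of Fin plays no role.
𝓑 : Set
𝓑 = Fin 4

pattern f = zero
pattern ⊥ = suc zero
pattern ⊤ = suc (suc zero)
pattern t = suc (suc (suc zero))

infix 4 _≤ₜ_ _≤ₜ?_ _≤ₖ_ _≤ₖ?_

_≤ₜ_ : Rel 𝓑 0ℓ
x ≤ₜ y = x ≡ f ⊎ x ≡ y ⊎ y ≡ t

_≤ₖ_ : Rel 𝓑 0ℓ
x ≤ₖ y = x ≡ ⊥ ⊎ x ≡ y ⊎ y ≡ ⊤

_≤ₜ?_ : Decidable _≤ₜ_
x ≤ₜ? y = (x ≟ f) ⊎-dec (x ≟ y) ⊎-dec (y ≟ t)

_≤ₖ?_ : Decidable _≤ₖ_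
x ≤ₖ? y = (x ≟ ⊥) ⊎-dec (x ≟ y) ⊎-dec (y ≟ ⊤)

infixr 7 _∧_ _⊗_
infixr 6 _∨_ _⊕_
infixr 5 _⇀_ _⇁_

_∧_ _∨_ _⇀_ : Op₂ 𝓑
f ∧ _ = f
t ∧ y = y
⊥ ∧ f = f
⊥ ∧ ⊥ = ⊥
⊥ ∧ ⊤ = f
⊥ ∧ t = ⊥
⊤ ∧ f = f
⊤ ∧ ⊥ = f
⊤ ∧ ⊤ = ⊤
⊤ ∧ t = ⊤

f ∨ y = y
t ∨ _ = t
⊥ ∨ f = ⊥
⊥ ∨ ⊥ = ⊥
⊥ ∨ ⊤ = t
⊥ ∨ t = t
⊤ ∨ f = ⊤
⊤ ∨ ⊥ = t
⊤ ∨ ⊤ = ⊤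
⊤ ∨ t = t

f ⇀ _ = t
t ⇀ y = y
⊥ ⇀ f = ⊤
⊥ ⇀ ⊥ = t
⊥ ⇀ ⊤ = ⊤
⊥ ⇀ t = t
⊤ ⇀ f = ⊥
⊤ ⇀ ⊥ = ⊥
⊤ ⇀ ⊤ = t
⊤ ⇀ t = t

_⊗_ _⊕_ _⇁_ : Op₂ 𝓑
⊥ ⊗ _ = ⊥
⊤ ⊗ y = y
f ⊗ f = f
f ⊗ ⊥ = ⊥
f ⊗ ⊤ = f
f ⊗ t = ⊥
t ⊗ f = ⊥
t ⊗ ⊥ = ⊥
t ⊗ ⊤ = t
t ⊗ t = t

⊥ ⊕ y = y
⊤ ⊕ _ = ⊤
f ⊕ f = f
f ⊕ ⊥ = f
f ⊕ ⊤ = ⊤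
f ⊕ t = ⊤
t ⊕ f = ⊤
t ⊕ ⊥ = t
t ⊕ ⊤ = ⊤
t ⊕ t = t

⊥ ⇁ _ = ⊤
⊤ ⇁ y = y
f ⇁ f = ⊤
f ⇁ ⊥ = t
f ⇁ ⊤ = ⊤
f ⇁ t = t
t ⇁ f = f
t ⇁ ⊥ = f
t ⇁ ⊤ = ⊤
t ⇁ t = ⊤

-- truth negation
neg : Op₁ 𝓑
neg f = t
neg ⊥ = ⊥
neg ⊤ = ⊤
neg t = f

-- conflation
conf : Op₁ 𝓑
conf f = f
conf ⊥ = ⊤
conf ⊤ = ⊥
conf t = t

∂ : 𝓑 → 𝓑
∂ f = ⊥
∂ ⊥ = f
∂ ⊤ = t
∂ t = ⊤

private
  module _ {_≤_ : Rel 𝓑 0ℓ} (_≤?_ : Decidable _≤_) (_∨_ _∧_ _⇒_ : Op₂ 𝓑) (top bot : 𝓑) where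

    HeytingLaws : Set
    HeytingLaws =
        (∀ x → x ≤ x)
      × (∀ x y → x ≤ y → y ≤ x → x ≡ y)
      × (∀ x y z → x ≤ y → y ≤ z → x ≤ z)
      × (∀ x y → x ≤ (x ∨ y) × y ≤ (x ∨ y) × (∀ z → x ≤ z → y ≤ z → (x ∨ y) ≤ z))
      × (∀ x y → (x ∧ y) ≤ x × (x ∧ y) ≤ y × (∀ z → z ≤ x → z ≤ y → z ≤ (x ∧ y)))
      × (∀ x → x ≤ top)
      × (∀ x → bot ≤ x)
      × (∀ w x y → ((w ∧ x) ≤ y → w ≤ (x ⇒ y)) × (w ≤ (x ⇒ y) → (w ∧ x) ≤ y))

    heytingLaws? : Dec HeytingLaws
    heytingLaws? =
            all? (λ x → x ≤? x)
      ×-dec all? (λ x → all? λ y → (x ≤? y) →-dec (y ≤? x) →-dec (x ≟ y))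
      ×-dec all? (λ x → all? λ y → all? λ z → (x ≤? y) →-dec (y ≤? z) →-dec (x ≤? z))
      ×-dec all? (λ x → all? λ y → (x ≤? (x ∨ y)) ×-dec (y ≤? (x ∨ y)) ×-dec
              all? (λ z → (x ≤? z) →-dec (y ≤? z) →-dec ((x ∨ y) ≤? z)))
      ×-dec all? (λ x → all? λ y → ((x ∧ y) ≤? x) ×-dec ((x ∧ y) ≤? y) ×-dec
              all? (λ z → (z ≤? x) →-dec (z ≤? y) →-dec (z ≤? (x ∧ y))))
      ×-dec all? (λ x → x ≤? top)
      ×-dec all? (λ x → bot ≤? x)
      ×-dec all? (λ w → all? λ x → all? λ y →
              (((w ∧ x) ≤? y) →-dec (w ≤? (x ⇒ y))) ×-dec ((w ≤? (x ⇒ y)) →-dec ((w ∧ x) ≤? y)))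

    mkHeyting : HeytingLaws → IsHeytingAlgebra _≡_ _≤_ _∨_ _∧_ _⇒_ top bot
    mkHeyting (≤-refl , ≤-antisym , ≤-trans , sup , inf , max , min , exp) = record
      { isBoundedLattice = record
        { isLattice = record
          { isPartialOrder = record
            { isPreorder = record
              { isEquivalence = isEquivalence
              ; reflexive     = λ { refl → ≤-refl _ }
              ; trans         = ≤-trans _ _ _
              }
            ; antisym = ≤-antisym _ _
            }
          ; supremum = sup
          ; infimum  = inf
          }
        ; maximum = max
        ; minimum = min
        }
      ; exponential = exp
      }

  module _ {_≤₁_ _≤₂_ : Rel 𝓑 0ℓ} (_≤₁?_ : Decidable _≤₁_) (_≤₂?_ : Decidable _≤₂_) (h : Op₁ 𝓑) where

    IsoLaws : Set
    IsoLaws =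
        (∀ x y → x ≤₁ y → h x ≤₂ h y)
      × (∀ x y → h x ≤₂ h y → x ≤₁ y)
      × (∀ x y → h x ≡ h y → x ≡ y)
      × (∀ y → ∃ λ x → h x ≡ y)

    isoLaws? : Dec IsoLaws
    isoLaws? =
            all? (λ x → all? λ y → (x ≤₁? y) →-dec (h x ≤₂? h y))
      ×-dec all? (λ x → all? λ y → (h x ≤₂? h y) →-dec (x ≤₁? y))
      ×-dec all? (λ x → all? λ y → (h x ≟ h y) →-dec (x ≟ y))
      ×-dec all? (λ y → any? λ x → h x ≟ y)

    mkIso : IsoLaws → IsOrderIsomorphism _≡_ _≡_ _≤₁_ _≤₂_ h
    mkIso (mono , cancel , inj , surj) = record
      { isOrderMonomorphism = record
        { isOrderHomomorphism = record { cong = cong h ; mono = mono _ _ }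
        ; injective           = inj _ _
        ; cancel              = cancel _ _
        }
      ; surjective = λ y → let x , eq = surj y in x , λ { refl → eq }
      }

∂-isOrderIsomorphism : IsOrderIsomorphism _≡_ _≡_ _≤ₜ_ _≤ₖ_ ∂
∂-isOrderIsomorphism = mkIso _≤ₜ?_ _≤ₖ?_ ∂ (from-yes (isoLaws? _≤ₜ?_ _≤ₖ?_ ∂))

∂-involutive : ∀ x → ∂ (∂ x) ≡ x
∂-involutive = from-yes (all? (λ x → ∂ (∂ x) ≟ x))

𝓑ₜ : AutoHeytingAlgebra 4
𝓑ₜ = record
  { _≤_ = _≤ₜ_ ; _≤?_ = _≤ₜ?_ ; _∨_ = _∨_ ; _∧_ = _∧_ ; _⇒_ = _⇀_ ; top = t ; bot = f
  ; isHeytingAlgebra = mkHeyting _≤ₜ?_ _∨_ _∧_ _⇀_ t f (from-yes (heytingLaws? _≤ₜ?_ _∨_ _∧_ _⇀_ t f))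
  ; ♭ = conf
  ; ♭-automorphism = mkIso _≤ₜ?_ _≤ₜ?_ conf (from-yes (isoLaws? _≤ₜ?_ _≤ₜ?_ conf))
  }

𝓑ₖ : AutoHeytingAlgebra 4
𝓑ₖ = record
  { _≤_ = _≤ₖ_ ; _≤?_ = _≤ₖ?_ ; _∨_ = _⊕_ ; _∧_ = _⊗_ ; _⇒_ = _⇁_ ; top = ⊤ ; bot = ⊥
  ; isHeytingAlgebra = mkHeyting _≤ₖ?_ _⊕_ _⊗_ _⇁_ ⊤ ⊥ (from-yes (heytingLaws? _≤ₖ?_ _⊕_ _⊗_ _⇁_ ⊤ ⊥))
  ; ♭ = neg
  ; ♭-automorphism = mkIso _≤ₖ?_ _≤ₖ?_ neg (from-yes (isoLaws? _≤ₖ?_ _≤ₖ?_ neg))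
  }

module T = AutoHeytingAlgebra 𝓑ₜ
module K = AutoHeytingAlgebra 𝓑ₖ

_ : T.↓⁺ f ≡ ⁅ f ⁆ × T.↓⁺ ⊥ ≡ ⁅ f ⁆ ∪ ⁅ ⊥ ⁆ × T.↓⁺ ⊤ ≡ ⁅ f ⁆ ∪ ⁅ ⊤ ⁆ × T.↓⁺ t ≡ ⁅ f ⁆ ∪ ⁅ ⊥ ⁆ ∪ ⁅ ⊤ ⁆
_ = refl , refl , refl , refl

_ : K.↓⁺ ⊥ ≡ ⁅ ⊥ ⁆ × K.↓⁺ f ≡ ⁅ ⊥ ⁆ ∪ ⁅ f ⁆ × K.↓⁺ t ≡ ⁅ ⊥ ⁆ ∪ ⁅ t ⁆ × K.↓⁺ ⊤ ≡ ⁅ ⊥ ⁆ ∪ ⁅ f ⁆ ∪ ⁅ t ⁆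
_ = refl , refl , refl , refl

------------------------------------------------------------------------
-- ∂ on sets

private
  image-∂-𝟏 : image ∂ T.𝟏 ≡ K.𝟏
  image-∂-𝟏 = refl

  image-∂-↓⁺ : ∀ x → K.↓⁺ (∂ x) ≡ image ∂ (T.↓⁺ x)
  image-∂-↓⁺ f = refl
  image-∂-↓⁺ ⊥ = refl
  image-∂-↓⁺ ⊤ = refl
  image-∂-↓⁺ t = refl

∂𝒫 : 𝒫 T.𝟏 → 𝒫 K.𝟏
∂𝒫 (X , [ X⊆𝟏 ]) = image ∂ X ,
  [ (λ y∈ → subst (image ∂ X ⊆_) image-∂-𝟏 (image-mono ∂ X⊆𝟏) y∈) ]

∂𝒫* : T.𝓑⁺ → K.𝓑⁺
∂𝒫* (X , [ p ]) = image ∂ X ,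
  [ (∂ (proj₁ p) , trans (image-∂-↓⁺ (proj₁ p)) (cong (image ∂) (proj₂ p))) ]

{-# OPTIONS --safe #-}
module Submission where

-- The image of subsets under an injection commutes with ∩ and with relative
-- pseudocomplements, and image ∂ intertwines the two diamonds because ∂
-- intertwines conflation and negation.  Since ⋁ inverts ↓⁺, every element of
-- 𝓑⁺ is some ↓ x, which transfers the laws of 𝓑 to 𝓑⁺.  The models 𝒫Model and
-- 𝔼 ∘ 𝔻 are definitionally equal.

open import Defs
open import Data.Bool.Properties as Bool using ()
open import Data.Fin.Base using (Fin)
open import Data.Fin.Properties using (_≟_; all?)
open import Data.Fin.Subset using (Subset; _∈_; _⊆_; _∩_; ⁅_⁆)
open import Data.Fin.Subset.Properties using (⊆-antisym; x∈p∩q⁺; x∈p∩q⁻; x∈⁅x⁆; x∈⁅y⁆⇒x≡y; _∈?_; _⊆?_; anySubset?)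
open import Data.Irrelevant using ([_])
open import Data.Nat.Base using (ℕ)
open import Data.Product using (Σ-syntax; ∃-syntax; _×_; _,_; proj₁; proj₂)
open import Data.Refinement using (_,_; value)
open import Data.Refinement.Properties using (value-injective)
open import Data.Vec.Properties using (≡-dec)
open import Function.Base using (_∘_)
open import Function.Bundles using (_⇔_; mk⇔)
open import Function.Consequences.Propositional using (strictlySurjective⇒surjective)
open import Function.Definitions using (Injective)
open import Relation.Binary.PropositionalEquality using (_≡_; _≗_; refl; sym; trans; cong; cong₂; subst; module ≡-Reasoning)
open import Relation.Binary.Definitions using (DecidableEquality)
open import Relation.Binary.Morphism.Structures using (module IsOrderIsomorphism)
open import Relation.Nullary.Decidable using (_×-dec_; from-yes; recompute)

private variable
  m n k : ℕ

infix 4 _≟ˢ_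

_≟ˢ_ : DecidableEquality (Subset n)
_≟ˢ_ = ≡-dec Bool._≟_

image-cong : {g h : Fin m → Fin n} → g ≗ h → image g ≗ image h
image-cong {g = g} {h} g≗h X = ⊆-antisym (half g≗h) (half (sym ∘ g≗h))
  where
  half : ∀ {g h} → g ≗ h → image g X ⊆ image h X
  half {g} {h} g≗h y∈ with x , x∈X , refl ← ∈-image⁻ g y∈ =
    subst (_∈ image h X) (sym (g≗h x)) (∈-image⁺ h x∈X)

image-∘ : (g : Fin n → Fin k) (h : Fin m → Fin n) → image g ∘ image h ≗ image (g ∘ h)
image-∘ g h X = ⊆-antisym to from
  where
  to : image g (image h X) ⊆ image (g ∘ h) X
  to z∈ with y , y∈ , refl ← ∈-image⁻ g z∈ with x , x∈X , refl ← ∈-image⁻ h y∈ =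
    ∈-image⁺ (g ∘ h) x∈X

  from : image (g ∘ h) X ⊆ image g (image h X)
  from z∈ with x , x∈X , refl ← ∈-image⁻ (g ∘ h) z∈ = ∈-image⁺ g (∈-image⁺ h x∈X)

image-id : (X : Subset n) → image (λ x → x) X ≡ X
image-id X = ⊆-antisym
  (λ y∈ → let x , x∈X , y≡x = ∈-image⁻ (λ x → x) y∈ in subst (_∈ X) (sym y≡x) x∈X)
  (∈-image⁺ (λ x → x))

image-involutive : (h : Fin n → Fin n) → (∀ x → h (h x) ≡ x) → ∀ X → image h (image h X) ≡ X
image-involutive h h∘h≗id X = begin
  image h (image h X)    ≡⟨ image-∘ h h X ⟩
  image (h ∘ h) X        ≡⟨ image-cong h∘h≗id X ⟩
  image (λ x → x) X      ≡⟨ image-id X ⟩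
  X                      ∎
  where open ≡-Reasoning

image-square : (h : Fin m → Fin n) (g : Fin m → Fin m) (g′ : Fin n → Fin n) →
  h ∘ g ≗ g′ ∘ h → image h ∘ image g ≗ image g′ ∘ image h
image-square h g g′ eq X =
  trans (image-∘ h g X) (trans (image-cong eq X) (sym (image-∘ g′ h X)))

module _ {W X Y : Subset n} where

  -- With `pseudocomplement-⊆` and `pseudocomplement-mp` this replaces the union over all `Z` by a
  -- pointwise condition: `w ∈ W`, and `w ∈ X` implies `w ∈ Y`.
  ∈-pseudocomplement⁺ : ∀ {w} → w ∈ W → (w ∈ X → w ∈ Y) → w ∈ pseudocomplement W X Y
  ∈-pseudocomplement⁺ {w} w∈W X→Y = ∈-comprehension⁺
    (λ w → anySubset? (λ Z → (Z ⊆? W) ×-dec ((Z ∩ X) ⊆? Y) ×-dec (w ∈? Z)))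
    -- The singleton is the smallest `Z` through which `w` can enter the union, and for it
    -- `Z ∩ X ⊆ Y` only concerns `w`.
    ( ⁅ w ⁆
    , (λ z∈ → subst (_∈ W) (sym (x∈⁅y⁆⇒x≡y w z∈)) w∈W)
    , (λ z∈ → let z∈w , z∈X = x∈p∩q⁻ ⁅ w ⁆ X z∈
                  z≡w       = x∈⁅y⁆⇒x≡y w z∈w
              in subst (_∈ Y) (sym z≡w) (X→Y (subst (_∈ X) z≡w z∈X)))
    , x∈⁅x⁆ w )

  pseudocomplement-mp : ∀ {w} → w ∈ pseudocomplement W X Y → w ∈ X → w ∈ Y
  pseudocomplement-mp w∈ w∈X with Z , _ , Z∩X⊆Y , w∈Z ← ∈-comprehension⁻
    (λ w → anySubset? (λ Z → (Z ⊆? W) ×-dec ((Z ∩ X) ⊆? Y) ×-dec (w ∈? Z))) w∈ =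
    Z∩X⊆Y (x∈p∩q⁺ (w∈Z , w∈X))

module _ {h : Fin m → Fin n} (h-injective : Injective _≡_ _≡_ h) where

  ∈-image-injective⁻ : ∀ {X x} → h x ∈ image h X → x ∈ X
  ∈-image-injective⁻ {X} hx∈ with _ , x′∈X , hx≡hx′ ← ∈-image⁻ h hx∈ =
    subst (_∈ X) (sym (h-injective hx≡hx′)) x′∈X

  image-∩ : ∀ X Y → image h (X ∩ Y) ≡ image h X ∩ image h Y
  image-∩ X Y = ⊆-antisym to from
    where
    to : image h (X ∩ Y) ⊆ image h X ∩ image h Y
    to z∈ with x , x∈ , refl ← ∈-image⁻ h z∈ with x∈X , x∈Y ← x∈p∩q⁻ X Y x∈ =
      x∈p∩q⁺ (∈-image⁺ h x∈X , ∈-image⁺ h x∈Y)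

    from : image h X ∩ image h Y ⊆ image h (X ∩ Y)
    from z∈ with z∈X , z∈Y ← x∈p∩q⁻ (image h X) (image h Y) z∈ with x , x∈X , refl ← ∈-image⁻ h z∈X =
      ∈-image⁺ h (x∈p∩q⁺ (x∈X , ∈-image-injective⁻ z∈Y))

  -- An injection both preserves and reflects membership in an image, so the pointwise implication
  -- transfers in both directions: reflection is applied to `X` in `to` and to `Y` in `from`.
  image-pseudocomplement : ∀ W X Y →
    image h (pseudocomplement W X Y) ≡ pseudocomplement (image h W) (image h X) (image h Y)
  image-pseudocomplement W X Y = ⊆-antisym to from
    where
    to : image h (pseudocomplement W X Y) ⊆ pseudocomplement (image h W) (image h X) (image h Y)
    to z∈ with w , w∈ , refl ← ∈-image⁻ h z∈ = ∈-pseudocomplement⁺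
      (∈-image⁺ h (pseudocomplement-⊆ W X Y w∈))
      (λ hw∈ → ∈-image⁺ h (pseudocomplement-mp {W = W} w∈ (∈-image-injective⁻ hw∈)))

    from : pseudocomplement (image h W) (image h X) (image h Y) ⊆ image h (pseudocomplement W X Y)
    from z∈ with w , w∈W , refl ← ∈-image⁻ h (pseudocomplement-⊆ _ (image h X) (image h Y) z∈) =
      ∈-image⁺ h (∈-pseudocomplement⁺ w∈W
        (λ w∈X → ∈-image-injective⁻ (pseudocomplement-mp {W = image h W} z∈ (∈-image⁺ h w∈X))))

module _ (A : AutoHeytingAlgebra n) where
  open AutoHeytingAlgebra A

  -- The hypothesis says that each element is the join of the join-irreducibles below it. It is
  -- checked by evaluation for each of the two orders.
  module Representation (⋁-↓⁺ : ∀ x → ⋁ (↓⁺ x) ≡ x) where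

    ↓-⋁ : (X : 𝓑⁺) → ↓ (⋁ (value X)) ≡ X
    -- The preimage in `p` is irrelevant, so the equation obtained from it is too; decidable
    -- equality of subsets makes it relevant again.
    ↓-⋁ (X , [ p ]) = value-injective (recompute (_ ≟ˢ X)
      (trans (cong (↓⁺ ∘ ⋁) (sym (proj₂ p))) (trans (cong ↓⁺ (⋁-↓⁺ _)) (proj₂ p))))

    ↓-isModelIsomorphism : {Var : Set} (I : Var → Fin n) → IsModelIsomorphism (baseModel I) (↓Model I) ↓
    ↓-isModelIsomorphism I = record
      { isModelHomomorphism = record
        { ∧-homo  = λ x y → value-injective (↓⁺-∧ x y)
        ; ⇒-homo  = λ x y → cong ↓ (sym (cong₂ _⇒_ (⋁-↓⁺ x) (⋁-↓⁺ y)))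
        ; ♭-homo  = λ x → value-injective (↓⁺-♭ x)
        ; ⟦⟧-homo = λ _ → refl
        }
      ; bijective =
          (λ {x} {y} eq → trans (sym (⋁-↓⁺ x)) (trans (cong (⋁ ∘ value) eq) (⋁-↓⁺ y)))
        , strictlySurjective⇒surjective (λ X → ⋁ (value X) , ↓-⋁ X)
      }

    -- Only `⇒` has different underlying sets in the two algebras: in `𝓑⁺` it is computed on
    -- suprema. The hypothesis turns this into a pseudocomplement of sets `↓⁺ (⋁ X)`, which `↓-⋁`
    -- reduces to `X`.
    inclusion-isModelMonomorphism :
      (∀ x y → ↓⁺ (x ⇒ y) ≡ pseudocomplement 𝟏 (↓⁺ x) (↓⁺ y)) →
      {Var : Set} (I : Var → Fin n) → IsModelMonomorphism (↓Model I) (𝒫Model I) inclusion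
    inclusion-isModelMonomorphism ↓⁺-⇒ I = record
      { isModelHomomorphism = record
        { ∧-homo  = λ _ _ → refl
        ; ⇒-homo  = λ X Y → value-injective (trans (↓⁺-⇒ _ _)
            (cong₂ (pseudocomplement 𝟏) (cong value (↓-⋁ X)) (cong value (↓-⋁ Y))))
        ; ♭-homo  = λ _ → refl
        ; ⟦⟧-homo = λ _ → refl
        }
      ; injective = λ eq → value-injective (cong value eq)
      }

-- This fails in a general Heyting algebra.  The join-irreducibles of 𝓑 form
-- an antichain, so the subsets of 𝟏 that contain the bottom are exactly the
-- sets ↓⁺ x, and the pseudocomplement in 𝒫 𝟏 is one of them because ↓⁺ y
-- contains the bottom.
T-↓⁺-⇒ : ∀ x y → T.↓⁺ (x ⇀ y) ≡ pseudocomplement T.𝟏 (T.↓⁺ x) (T.↓⁺ y)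
T-↓⁺-⇒ = from-yes (all? λ x → all? λ y →
  T.↓⁺ (x ⇀ y) ≟ˢ pseudocomplement T.𝟏 (T.↓⁺ x) (T.↓⁺ y))

K-↓⁺-⇒ : ∀ x y → K.↓⁺ (x ⇁ y) ≡ pseudocomplement K.𝟏 (K.↓⁺ x) (K.↓⁺ y)
K-↓⁺-⇒ = from-yes (all? λ x → all? λ y →
  K.↓⁺ (x ⇁ y) ≟ˢ pseudocomplement K.𝟏 (K.↓⁺ x) (K.↓⁺ y))

T-⋁-↓⁺ : ∀ x → T.⋁ (T.↓⁺ x) ≡ x
T-⋁-↓⁺ = from-yes (all? λ x → T.⋁ (T.↓⁺ x) ≟ x)

K-⋁-↓⁺ : ∀ x → K.⋁ (K.↓⁺ x) ≡ x
K-⋁-↓⁺ = from-yes (all? λ x → K.⋁ (K.↓⁺ x) ≟ x)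

module TR = Representation 𝓑ₜ T-⋁-↓⁺
module KR = Representation 𝓑ₖ K-⋁-↓⁺

∂-injective : Injective _≡_ _≡_ ∂
∂-injective = IsOrderIsomorphism.injective ∂-isOrderIsomorphism

∂-⇒ : ∀ x y → ∂ (x ⇀ y) ≡ ∂ x ⇁ ∂ y
∂-⇒ = from-yes (all? λ x → all? λ y → ∂ (x ⇀ y) ≟ (∂ x ⇁ ∂ y))

∂-conf : ∀ x → ∂ (conf x) ≡ neg (∂ x)
∂-conf = from-yes (all? λ x → ∂ (conf x) ≟ neg (∂ x))

-- An order isomorphism carries bottom to bottom and join-irreducibles to join-irreducibles. This is
-- the upper square on underlying sets, and also the compatibility of the interpretations.
image-∂-↓⁺ : ∀ x → K.↓⁺ (∂ x) ≡ image ∂ (T.↓⁺ x)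
image-∂-↓⁺ = from-yes (all? λ x → K.↓⁺ (∂ x) ≟ˢ image ∂ (T.↓⁺ x))

image-∂-conf : image ∂ ∘ image conf ≗ image neg ∘ image ∂
image-∂-conf = image-square ∂ conf neg ∂-conf

-- This lets `∂𝒫*` preserve implications, which are computed on suprema. `X` is `↓⁺` of its
-- supremum, `image ∂` sends that set to `↓⁺` of the image of the supremum, and `K.⋁` recovers the
-- latter.
∂-⋁ : (X : T.𝓑⁺) → ∂ (T.⋁ (value X)) ≡ K.⋁ (image ∂ (value X))
∂-⋁ X = begin
  ∂ (T.⋁ (value X))                      ≡⟨ K-⋁-↓⁺ (∂ (T.⋁ (value X))) ⟨
  K.⋁ (K.↓⁺ (∂ (T.⋁ (value X))))         ≡⟨ cong K.⋁ (image-∂-↓⁺ (T.⋁ (value X))) ⟩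
  K.⋁ (image ∂ (T.↓⁺ (T.⋁ (value X))))   ≡⟨ cong (K.⋁ ∘ image ∂ ∘ value) (TR.↓-⋁ X) ⟩
  K.⋁ (image ∂ (value X))                ∎
  where open ≡-Reasoning

∂-isModelIsomorphism : {Var : Set} (I : Var → 𝓑) →
  IsModelIsomorphism (T.baseModel I) (K.baseModel (∂ ∘ I)) ∂
∂-isModelIsomorphism I = record
  { isModelHomomorphism = record
    { ∧-homo  = from-yes (all? λ x → all? λ y → ∂ (x ∧ y) ≟ (∂ x ⊗ ∂ y))
    ; ⇒-homo  = ∂-⇒
    ; ♭-homo  = ∂-conf
    ; ⟦⟧-homo = λ _ → refl
    }
  ; bijective = ∂-injective , strictlySurjective⇒surjective (λ y → ∂ y , ∂-involutive y)
  }

∂𝒫*-isModelHomomorphism : {Var : Set} (I : Var → 𝓑) →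
  IsModelHomomorphism (T.↓Model I) (K.↓Model (∂ ∘ I)) ∂𝒫*
∂𝒫*-isModelHomomorphism I = record
  { ∧-homo  = λ X Y → value-injective (image-∩ ∂-injective (value X) (value Y))
  ; ⇒-homo  = λ X Y → value-injective (trans
      (sym (image-∂-↓⁺ (T.⋁ (value X) ⇀ T.⋁ (value Y))))
      (cong K.↓⁺ (trans (∂-⇒ (T.⋁ (value X)) (T.⋁ (value Y))) (cong₂ _⇁_ (∂-⋁ X) (∂-⋁ Y)))))
  ; ♭-homo  = λ X → value-injective (image-∂-conf (value X))
  ; ⟦⟧-homo = λ p → value-injective (sym (image-∂-↓⁺ (I p)))
  }

-- Since `∂` is an involution, `image ∂` is its own inverse; `image ∂ K.𝟏` evaluates to `T.𝟏`.
∂𝒫⁻¹ : 𝒫 K.𝟏 → 𝒫 T.𝟏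
∂𝒫⁻¹ (Y , [ Y⊆𝟏 ]) = image ∂ Y , [ (λ x∈ → image-mono ∂ Y⊆𝟏 x∈) ]

∂𝒫-isModelIsomorphism : {Var : Set} (I : Var → 𝓑) →
  IsModelIsomorphism (T.𝒫Model I) (K.𝒫Model (∂ ∘ I)) ∂𝒫
∂𝒫-isModelIsomorphism I = record
  { isModelHomomorphism = record
    { ∧-homo  = λ X Y → value-injective (image-∩ ∂-injective (value X) (value Y))
    ; ⇒-homo  = λ X Y → value-injective (image-pseudocomplement ∂-injective T.𝟏 (value X) (value Y))
    ; ♭-homo  = λ X → value-injective (image-∂-conf (value X))
    ; ⟦⟧-homo = λ p → value-injective (sym (image-∂-↓⁺ (I p)))
    }
  ; bijective =
      (λ {X} {Y} eq → value-injective (trans (sym (image-involutive ∂ ∂-involutive (value X)))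
        (trans (cong (image ∂ ∘ value) eq) (image-involutive ∂ ∂-involutive (value Y)))))
    , strictlySurjective⇒surjective
        (λ Y → ∂𝒫⁻¹ Y , value-injective (image-involutive ∂ ∂-involutive (value Y)))
  }

-- This expresses that `∂𝒫*` maps the first `𝓑⁺` onto the second, as families of subsets. The
-- preimage of `K.↓⁺ y` is `T.↓⁺ (∂ y)`, again by involutivity.
Is↓⁺⇔image-∂ : (Y : Subset 4) → K.Is↓⁺ Y ⇔ (∃[ X ] (T.Is↓⁺ X × image ∂ X ≡ Y))
Is↓⁺⇔image-∂ Y = mk⇔
  (λ (y , ↓y≡Y) → T.↓⁺ (∂ y) , (∂ y , refl) ,
    trans (sym (image-∂-↓⁺ (∂ y))) (trans (cong K.↓⁺ (∂-involutive y)) ↓y≡Y))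
  (λ { (_ , (x , refl) , ∂X≡Y) → ∂ x , trans (image-∂-↓⁺ x) ∂X≡Y })

theorem5 : {Var : Set} (I : Var → 𝓑) →
    let I′ = ∂ ∘ I in
      image ∂ T.𝟏 ≡ K.𝟏
    × ((Y : Subset 4) → K.Is↓⁺ Y ⇔ (∃[ X ] (T.Is↓⁺ X × image ∂ X ≡ Y)))
    × IsModelIsomorphism (T.baseModel I) (K.baseModel I′) ∂
    × IsModelIsomorphism (T.baseModel I) (T.↓Model I) T.↓
    × IsModelIsomorphism (K.baseModel I′) (K.↓Model I′) K.↓
    × IsModelHomomorphism (T.↓Model I) (K.↓Model I′) ∂𝒫*
    × IsModelMonomorphism (T.↓Model I) (T.𝒫Model I) T.inclusion
    × IsModelMonomorphism (K.↓Model I′) (K.𝒫Model I′) K.inclusion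
    × IsModelIsomorphism (T.𝒫Model I) (K.𝒫Model I′) ∂𝒫
    × IsModelIsomorphism (𝔼 (𝔻 𝓑ₜ I)) (𝔼 (𝔻 𝓑ₖ I′)) ∂𝒫
    × K.↓ ∘ ∂ ≗ ∂𝒫* ∘ T.↓
    × K.inclusion ∘ ∂𝒫* ≗ ∂𝒫 ∘ T.inclusion
    × (Σ[ eqₜ ∈ T.𝒫Model I ≡ 𝔼 (𝔻 𝓑ₜ I) ] Σ[ eqₖ ∈ K.𝒫Model I′ ≡ 𝔼 (𝔻 𝓑ₖ I′) ]
         subst Model.Carrier eqₖ ∘ ∂𝒫 ≗ ∂𝒫 ∘ subst Model.Carrier eqₜ)
theorem5 I =
    refl
  , Is↓⁺⇔image-∂
  , ∂-isModelIsomorphism I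
  , TR.↓-isModelIsomorphism I
  , KR.↓-isModelIsomorphism (∂ ∘ I)
  , ∂𝒫*-isModelHomomorphism I
  , TR.inclusion-isModelMonomorphism T-↓⁺-⇒ I
  , KR.inclusion-isModelMonomorphism K-↓⁺-⇒ (∂ ∘ I)
  , ∂𝒫-isModelIsomorphism I
  -- In `𝔻` the relation `R w v` is `w ≡ ♭ v`, so the diamond of `𝔼` unfolds to `image ♭` and the
  -- same proof applies.
  , ∂𝒫-isModelIsomorphism I
  , (λ x → value-injective (image-∂-↓⁺ x))
  , (λ _ → refl)
  -- Transport along `refl` is the identity, so both sides of the lowest square reduce to `∂𝒫`.
  , refl , refl , λ _ → refl
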